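{- For every positive integer $n$, $$t(n)\le \left[\frac{[\sqrt n]-1}{2}\right]+[\sqrt n]+7,$$ where $[x]$ denotes the greatest integer not exceeding $x$.
   Context: A $\mathbb Z$-lattice is a free $\mathbb Z$-module of finite rank equipped with a positive definite symmetric bilinear form with values in $\mathbb Z$; $Q(\bm x)=B(\bm x,\bm x)$. An integer $m$ is represented by $L$ if $m=Q(\bm x)$ for some $\bm x\in L$. For a positive integer $n$, $\mathcal T(n)$ is the set of all integers $\ge n$. A $\mathbb Z$-lattice $L$ is tight $\mathcal T(n)$-universal if the set of nonzero integers represented by $L$ is exactly $\mathcal T(n)$. $t(n)$ denotes the smallest rank of a tight $\mathcal T(n)$-universal $\mathbb Z$-lattice. -}

module Defs where

open import Data.Nat using (ℕ; zero; suc)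
open import Data.Fin using (Fin; zero; suc)
open import Data.Integer using (ℤ; +_; _+_; _*_; _<_; _≤_; 0ℤ)
open import Data.Product using (Σ; _×_; ∃)
open import Relation.Nullary using (¬_)
open import Relation.Binary.PropositionalEquality using (_≡_; _≢_)
open import Function.Bundles using (_⇔_)

∑ : {r : ℕ} → (Fin r → ℤ) → ℤ
∑ {zero}  f = 0ℤ
∑ {suc r} f = f zero + ∑ (λ i → f (suc i))

-- A ℤ-lattice of rank r, given by its Gram matrix w.r.t. a ℤ-basis:
-- B(e_i, e_j) = G i j ∈ ℤ.
Gram : ℕ → Set
Gram r = Fin r → Fin r → ℤ

Symmetric : {r : ℕ} → Gram r → Set
Symmetric G = ∀ i j → G i j ≡ G j i

Q : {r : ℕ} → Gram r → (Fin r → ℤ) → ℤ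
Q G x = ∑ (λ i → ∑ (λ j → x i * G i j * x j))

PositiveDefinite : {r : ℕ} → Gram r → Set
PositiveDefinite G = ∀ x → ¬ (∀ i → x i ≡ 0ℤ) → 0ℤ < Q G x

IsZLattice : {r : ℕ} → Gram r → Set
IsZLattice G = Symmetric G × PositiveDefinite G

Represents : {r : ℕ} → Gram r → ℤ → Set
Represents G m = ∃ λ x → Q G x ≡ m

TightUniversal : {r : ℕ} → ℕ → Gram r → Set
TightUniversal n G = ∀ (m : ℤ) → ((m ≢ 0ℤ) × Represents G m) ⇔ (+ n ≤ m)

{-# OPTIONS --safe #-}
module Submission where

-- Let M be the diagonal lattice on b_0, …, b_{q-1}, a_0, …, a_{p-1} with norms ⌊n/2⌋ + j and
-- ⌈n/2⌉ + i q, and let K be the sublattice of vectors with even coordinate sum 2 z₀, carrying the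
-- form of M plus g z₀². A nonzero vector of K has either two nonzero coordinates or an even one, so
-- its norm is at least n. The vectors b_j - a_i and b_j + a_i have norms n + (j + i q) and
-- n + (j + i q) + g, so for n ≥ 2 and g = p q every integer in [n , n + 2 p q) is represented by K.
-- With q = s + 2 and p = ⌊(s - 1) / 2⌋ + 1 this interval contains [n , 2 n), and the orthogonal sum
-- of K with n (x₁² + x₂² + x₃² + x₄²) represents everything above n by Lagrange's theorem. Its rank
-- is 4 + p + q, which is the claimed bound.

open import Defs
import Data.Nat as ℕ
import Data.Nat.Properties as ℕ
import Data.Nat.Tactic.RingSolver as ℕSolver
open import Data.Product using (Σ; ∃; ∃₂; _×_; _,_)
open import Data.Sum using (_⊎_; inj₁; inj₂; [_,_]′)
open import Function using (_∘_; mk⇔)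
open import Relation.Binary.Definitions using (tri<; tri≈; tri>)
open import Relation.Binary.PropositionalEquality
open import Relation.Nullary using (¬_; yes; no; contradiction)

-- Lagrange's theorem: Euler's four-square identity.

module FourSquares where

  open import Data.Nat using (ℕ; z≤n; s≤s; NonZero)
  open import Data.Nat.DivMod using (_mod_; m≡m%n+[m/n]*n; m%n<n; m/n*n≤m)
  open import Data.Nat.Divisibility using (_∣_; divides; ∣⇒≤; ∣m+n∣m⇒∣n)
  open import Data.Nat.Induction using (<-wellFounded; Acc; acc)
  open import Data.Nat.ListAction using (product)
  open import Data.Nat.Primality using (Prime; euclidsLemma; prime⇒irreducible; prime⇒nonZero; prime⇒nonTrivial)
  open import Data.Nat.Primality.Factorisation using (factorise; PrimeFactorisation)
  open import Data.Fin using (Fin; toℕ; splitAt; opposite; join)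
  open import Data.Fin.Properties
    using (pigeonhole; toℕ-injective; toℕ<n; toℕ-fromℕ<; opposite-prop; opposite-involutive; join-splitAt)
  open import Data.Integer hiding (suc; NonZero)
  open import Data.Integer.Properties
  open import Data.Integer.DivMod using (_/ℕ_; _%ℕ_; n%ℕd<d; a≡a%ℕn+[a/ℕn]*n)
  open import Data.Integer.Tactic.RingSolver using (solve-∀)
  open import Data.List.Base using ([]; _∷_)
  open import Data.List.Relation.Unary.All using (All; []; _∷_)

  SumOfFourSquares : ℤ → Set
  SumOfFourSquares n = ∃₂ λ a b → ∃₂ λ c d → n ≡ a * a + b * b + c * c + d * d

  -- Multiplicativity of the quaternion norm: up to the sign of the imaginary part, the four
  -- bilinear forms are the coordinates of the first quaternion times the conjugate of the second.
  euler : ∀ a b c d x y z w → (a * a + b * b + c * c + d * d) * (x * x + y * y + z * z + w * w) ≡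
    (a * x + b * y + c * z + d * w) * (a * x + b * y + c * z + d * w)
    + (a * y - b * x + c * w - d * z) * (a * y - b * x + c * w - d * z)
    + (a * z - c * x + d * y - b * w) * (a * z - c * x + d * y - b * w)
    + (a * w - d * x + b * z - c * y) * (a * w - d * x + b * z - c * y)
  euler = solve-∀

  *-sumOfFourSquares : ∀ {m n} → SumOfFourSquares m → SumOfFourSquares n → SumOfFourSquares (m * n)
  *-sumOfFourSquares (a , b , c , d , refl) (x , y , z , w , refl) =
    a * x + b * y + c * z + d * w , a * y - b * x + c * w - d * z ,
    a * z - c * x + d * y - b * w , a * w - d * x + b * z - c * y , euler a b c d x y z w

  -- Euler's identity for x = y + m k and y: there the four bilinear forms are divisible by m.
  euler-congruent : ∀ m r y₁ y₂ y₃ y₄ k₁ k₂ k₃ k₄ →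
    m * r ≡ y₁ * y₁ + y₂ * y₂ + y₃ * y₃ + y₄ * y₄ →
    let x₁ = y₁ + m * k₁; x₂ = y₂ + m * k₂; x₃ = y₃ + m * k₃; x₄ = y₄ + m * k₄
        w₁ = r + (k₁ * y₁ + k₂ * y₂ + k₃ * y₃ + k₄ * y₄)
        w₂ = k₁ * y₂ - k₂ * y₁ + k₃ * y₄ - k₄ * y₃
        w₃ = k₁ * y₃ - k₃ * y₁ + k₄ * y₂ - k₂ * y₄
        w₄ = k₁ * y₄ - k₄ * y₁ + k₂ * y₃ - k₃ * y₂
    in (x₁ * x₁ + x₂ * x₂ + x₃ * x₃ + x₄ * x₄) * (m * r)
       ≡ m * m * (w₁ * w₁ + w₂ * w₂ + w₃ * w₃ + w₄ * w₄)
  euler-congruent m r y₁ y₂ y₃ y₄ k₁ k₂ k₃ k₄ eq = trans (cong (X *_) eq) (trans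
    (expand m y₁ y₂ y₃ y₄ k₁ k₂ k₃ k₄) (trans
    (cong (λ t → (t + m * K) * (t + m * K) + m * m * W) (sym eq)) (collect m r K _ _ _)))
    where
    X = (y₁ + m * k₁) * (y₁ + m * k₁) + (y₂ + m * k₂) * (y₂ + m * k₂)
      + (y₃ + m * k₃) * (y₃ + m * k₃) + (y₄ + m * k₄) * (y₄ + m * k₄)
    K = k₁ * y₁ + k₂ * y₂ + k₃ * y₃ + k₄ * y₄
    W = (k₁ * y₂ - k₂ * y₁ + k₃ * y₄ - k₄ * y₃) * (k₁ * y₂ - k₂ * y₁ + k₃ * y₄ - k₄ * y₃)
      + (k₁ * y₃ - k₃ * y₁ + k₄ * y₂ - k₂ * y₄) * (k₁ * y₃ - k₃ * y₁ + k₄ * y₂ - k₂ * y₄)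
      + (k₁ * y₄ - k₄ * y₁ + k₂ * y₃ - k₃ * y₂) * (k₁ * y₄ - k₄ * y₁ + k₂ * y₃ - k₃ * y₂)

    expand : ∀ m y₁ y₂ y₃ y₄ k₁ k₂ k₃ k₄ →
      ((y₁ + m * k₁) * (y₁ + m * k₁) + (y₂ + m * k₂) * (y₂ + m * k₂)
        + (y₃ + m * k₃) * (y₃ + m * k₃) + (y₄ + m * k₄) * (y₄ + m * k₄))
      * (y₁ * y₁ + y₂ * y₂ + y₃ * y₃ + y₄ * y₄) ≡
      (y₁ * y₁ + y₂ * y₂ + y₃ * y₃ + y₄ * y₄ + m * (k₁ * y₁ + k₂ * y₂ + k₃ * y₃ + k₄ * y₄))
      * (y₁ * y₁ + y₂ * y₂ + y₃ * y₃ + y₄ * y₄ + m * (k₁ * y₁ + k₂ * y₂ + k₃ * y₃ + k₄ * y₄))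
      + m * m *
      ((k₁ * y₂ - k₂ * y₁ + k₃ * y₄ - k₄ * y₃) * (k₁ * y₂ - k₂ * y₁ + k₃ * y₄ - k₄ * y₃)
      + (k₁ * y₃ - k₃ * y₁ + k₄ * y₂ - k₂ * y₄) * (k₁ * y₃ - k₃ * y₁ + k₄ * y₂ - k₂ * y₄)
      + (k₁ * y₄ - k₄ * y₁ + k₂ * y₃ - k₃ * y₂) * (k₁ * y₄ - k₄ * y₁ + k₂ * y₃ - k₃ * y₂))
    expand = solve-∀

    collect : ∀ m r k u v w → (m * r + m * k) * (m * r + m * k) + m * m * (u + v + w)
      ≡ m * m * ((r + k) * (r + k) + u + v + w)
    collect = solve-∀

  -- Balanced remainders and the size of their sum of squares.

  i*i≡+∣i∣*∣i∣ : ∀ i → i * i ≡ + (∣ i ∣ ℕ.* ∣ i ∣)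
  i*i≡+∣i∣*∣i∣ (+ n)    = sym (pos-* n n)
  i*i≡+∣i∣*∣i∣ -[1+ n ] = refl

  -- The Euclidean remainder `r` is kept when `2 r ≤ m` and replaced by `r - m` otherwise. The bound
  -- cannot be strict when `m` is even; its equality case is what `remainder-max` isolates.
  balancedRemainder : ∀ i m .{{_ : NonZero m}} →
    ∃₂ λ y k → i ≡ y + + m * k × ∣ y ∣ ℕ.+ ∣ y ∣ ℕ.≤ m
  balancedRemainder i m with i %ℕ m in eq
  ... | r with (r ℕ.+ r) ℕ.≤? m
  ...   | yes 2r≤m = + r , i /ℕ m , trans decomposition (cong (_+_ (+ r)) (*-comm (i /ℕ m) (+ m))) , 2r≤m
    where
    decomposition : i ≡ + r + (i /ℕ m) * + m
    decomposition = subst (λ t → i ≡ + t + (i /ℕ m) * + m) eq (a≡a%ℕn+[a/ℕn]*n i m)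
  ...   | no 2r≰m = - + s , i /ℕ m + 1ℤ , shifted , bound
    where
    r≤m : r ℕ.≤ m
    r≤m = ℕ.<⇒≤ (subst (ℕ._< m) eq (n%ℕd<d i m))
    s = m ℕ.∸ r
    r+s≡m : r ℕ.+ s ≡ m
    r+s≡m = ℕ.m+[n∸m]≡n r≤m
    regroup : ∀ r s q → r + q * (r + s) ≡ - s + (r + s) * (q + 1ℤ)
    regroup = solve-∀
    shifted : i ≡ - + s + + m * (i /ℕ m + 1ℤ)
    shifted = begin
      i                                          ≡⟨ a≡a%ℕn+[a/ℕn]*n i m ⟩
      + (i %ℕ m) + (i /ℕ m) * + m                ≡⟨ cong (λ t → + t + (i /ℕ m) * + m) eq ⟩
      + r + (i /ℕ m) * + m                       ≡⟨ cong (λ t → + r + (i /ℕ m) * + t) (sym r+s≡m) ⟩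
      + r + (i /ℕ m) * (+ r + + s)               ≡⟨ regroup (+ r) (+ s) (i /ℕ m) ⟩
      - + s + (+ r + + s) * (i /ℕ m + 1ℤ)        ≡⟨ cong (λ t → - + s + + t * (i /ℕ m + 1ℤ)) r+s≡m ⟩
      - + s + + m * (i /ℕ m + 1ℤ)                ∎
      where open ≡-Reasoning
    s≤r : s ℕ.≤ r
    s≤r = ℕ.+-cancelˡ-≤ r s r (subst (ℕ._≤ r ℕ.+ r) (sym r+s≡m) (ℕ.<⇒≤ (ℕ.≰⇒> 2r≰m)))
    bound : ∣ - + s ∣ ℕ.+ ∣ - + s ∣ ℕ.≤ m
    bound rewrite ∣-i∣≡∣i∣ (+ s) = ℕ.≤-trans (ℕ.+-monoˡ-≤ s s≤r) (ℕ.≤-reflexive r+s≡m)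

  ≤-+-tight : ∀ {a b c d} → a ℕ.≤ c → b ℕ.≤ d → a ℕ.+ b ≡ c ℕ.+ d → a ≡ c × b ≡ d
  ≤-+-tight {a} {b} {c} {d} a≤c b≤d eq = a≡c , ℕ.+-cancelˡ-≡ a b d (trans eq (cong (ℕ._+ d) (sym a≡c)))
    where
    a≡c : a ≡ c
    a≡c = ℕ.≤-antisym a≤c (ℕ.+-cancelʳ-≤ d c a (subst (ℕ._≤ a ℕ.+ d) eq (ℕ.+-monoʳ-≤ a b≤d)))

  m*m≡n*n⇒m≡n : ∀ {m n} → m ℕ.* m ≡ n ℕ.* n → m ≡ n
  m*m≡n*n⇒m≡n {m} {n} eq with ℕ.<-cmp m n
  ... | tri< m<n _ _ = contradiction eq (ℕ.<⇒≢ (ℕ.*-mono-< m<n m<n))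
  ... | tri≈ _ m≡n _ = m≡n
  ... | tri> _ _ n<m = contradiction (sym eq) (ℕ.<⇒≢ (ℕ.*-mono-< n<m n<m))

  module _ {m : ℕ} .{{_ : NonZero m}} (a b c d : ℕ)
    (2a≤m : a ℕ.+ a ℕ.≤ m) (2b≤m : b ℕ.+ b ℕ.≤ m) (2c≤m : c ℕ.+ c ℕ.≤ m) (2d≤m : d ℕ.+ d ℕ.≤ m) where

    private
      4Σ : ∀ a b c d → (a ℕ.+ a) ℕ.* (a ℕ.+ a) ℕ.+ ((b ℕ.+ b) ℕ.* (b ℕ.+ b)
        ℕ.+ ((c ℕ.+ c) ℕ.* (c ℕ.+ c) ℕ.+ (d ℕ.+ d) ℕ.* (d ℕ.+ d)))
        ≡ 4 ℕ.* (a ℕ.* a ℕ.+ b ℕ.* b ℕ.+ c ℕ.* c ℕ.+ d ℕ.* d)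
      4Σ = ℕSolver.solve-∀
      4* : ∀ m → 4 ℕ.* m ≡ m ℕ.+ (m ℕ.+ (m ℕ.+ m))
      4* = ℕSolver.solve-∀
      cd≤ = ℕ.+-mono-≤ (ℕ.*-mono-≤ 2c≤m 2c≤m) (ℕ.*-mono-≤ 2d≤m 2d≤m)
      bcd≤ = ℕ.+-mono-≤ (ℕ.*-mono-≤ 2b≤m 2b≤m) cd≤

    -- Multiplying by 4 turns each square into `(2 a)²`, which is at most `m²`; hence
    -- `4 m r ≤ 4 m²`.
    remainder-≤ : ∀ {r} → m ℕ.* r ≡ a ℕ.* a ℕ.+ b ℕ.* b ℕ.+ c ℕ.* c ℕ.+ d ℕ.* d → r ℕ.≤ m
    remainder-≤ {r} eq = ℕ.*-cancelˡ-≤ m (ℕ.*-cancelˡ-≤ 4 (ℕ.≤-trans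
      (ℕ.≤-reflexive (trans (cong (4 ℕ.*_) eq) (sym (4Σ a b c d))))
      (ℕ.≤-trans (ℕ.+-mono-≤ (ℕ.*-mono-≤ 2a≤m 2a≤m) bcd≤) (ℕ.≤-reflexive (sym (4* (m ℕ.* m)))))))

    -- Equality in the estimate behind `remainder-≤`, so each of the four bounds that were added is
    -- attained.
    remainder-max : m ℕ.* m ≡ a ℕ.* a ℕ.+ b ℕ.* b ℕ.+ c ℕ.* c ℕ.+ d ℕ.* d →
      (a ℕ.+ a ≡ m × b ℕ.+ b ≡ m) × (c ℕ.+ c ≡ m × d ℕ.+ d ≡ m)
    remainder-max eq
      with a≡ , bcd≡ ← ≤-+-tight (ℕ.*-mono-≤ 2a≤m 2a≤m) bcd≤
             (trans (4Σ a b c d) (trans (cong (4 ℕ.*_) (sym eq)) (4* (m ℕ.* m))))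
      with b≡ , cd≡ ← ≤-+-tight (ℕ.*-mono-≤ 2b≤m 2b≤m) cd≤ bcd≡
      with c≡ , d≡ ← ≤-+-tight (ℕ.*-mono-≤ 2c≤m 2c≤m) (ℕ.*-mono-≤ 2d≤m 2d≤m) cd≡
      = (m*m≡n*n⇒m≡n a≡ , m*m≡n*n⇒m≡n b≡) , (m*m≡n*n⇒m≡n c≡ , m*m≡n*n⇒m≡n d≡)

  -- Descent on the multiplier of a prime.

  m∤p : ∀ {m p} → Prime p → 1 ℕ.< m → m ℕ.< p → ∀ z → + p ≢ + m * z
  m∤p {m} {p} p-prime 1<m m<p z eq with prime⇒irreducible p-prime
    (divides (∣ z ∣) (trans (cong ∣_∣ eq) (trans (abs-* (+ m) z) (ℕ.*-comm m (∣ z ∣)))))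
  ... | inj₁ refl = ℕ.<-irrefl refl 1<m
  ... | inj₂ refl = ℕ.<-irrefl refl m<p

  -- Brings the extreme case `r = 0` of the descent to the form needed there, with quotient 0; the
  -- next lemma does so for `r = m`, with quotient 1 or -1.
  ∣y∣²≡0⇒m∣2y : ∀ m y → ∣ y ∣ ℕ.* ∣ y ∣ ≡ 0 → ∃ λ j → y + y ≡ + m * j
  ∣y∣²≡0⇒m∣2y m y eq = 0ℤ , trans (cong (λ t → t + t) (∣i∣≡0⇒i≡0 {y} (m*m≡n*n⇒m≡n eq))) (sym (*-zeroʳ (+ m)))

  ∣2y∣≡m⇒m∣2y : ∀ {m} y → ∣ y ∣ ℕ.+ ∣ y ∣ ≡ m → ∃ λ j → y + y ≡ + m * j
  ∣2y∣≡m⇒m∣2y (+ n)    refl = 1ℤ , sym (*-identityʳ (+ (n ℕ.+ n)))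
  ∣2y∣≡m⇒m∣2y -[1+ n ] refl = -1ℤ , lemma (+ ℕ.suc n)
    where
    lemma : ∀ i → - i + - i ≡ (i + i) * -1ℤ
    lemma = solve-∀

  -- Since p = r + ∑ 2 yᵢ kᵢ + m ∑ kᵢ² with m r = ∑ yᵢ², the extreme values r = 0 and r = m, where
  -- m divides every 2 yᵢ, would force m ∣ p; otherwise the descent continues with r < m.
  module _ (m p y₁ y₂ y₃ y₄ k₁ k₂ k₃ k₄ : ℤ) where

    private
      x₁ = y₁ + m * k₁
      x₂ = y₂ + m * k₂
      x₃ = y₃ + m * k₃
      x₄ = y₄ + m * k₄

    cofactor : ℤ
    cofactor = p - ((y₁ + y₁) * k₁ + (y₂ + y₂) * k₂ + (y₃ + y₃) * k₃ + (y₄ + y₄) * k₄)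
      - m * (k₁ * k₁ + k₂ * k₂ + k₃ * k₃ + k₄ * k₄)

    m*cofactor : m * p ≡ x₁ * x₁ + x₂ * x₂ + x₃ * x₃ + x₄ * x₄ →
      m * cofactor ≡ y₁ * y₁ + y₂ * y₂ + y₃ * y₃ + y₄ * y₄
    m*cofactor eq = trans (distribute m p _ _) (trans
      (cong (λ t → t - m * A - m * (m * K)) eq) (cancel m y₁ y₂ y₃ y₄ k₁ k₂ k₃ k₄))
      where
      A = (y₁ + y₁) * k₁ + (y₂ + y₂) * k₂ + (y₃ + y₃) * k₃ + (y₄ + y₄) * k₄
      K = k₁ * k₁ + k₂ * k₂ + k₃ * k₃ + k₄ * k₄
      distribute : ∀ m p a k → m * (p - a - m * k) ≡ m * p - m * a - m * (m * k)
      distribute = solve-∀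
      cancel : ∀ m y₁ y₂ y₃ y₄ k₁ k₂ k₃ k₄ →
        (y₁ + m * k₁) * (y₁ + m * k₁) + (y₂ + m * k₂) * (y₂ + m * k₂)
        + (y₃ + m * k₃) * (y₃ + m * k₃) + (y₄ + m * k₄) * (y₄ + m * k₄)
        - m * ((y₁ + y₁) * k₁ + (y₂ + y₂) * k₂ + (y₃ + y₃) * k₃ + (y₄ + y₄) * k₄)
        - m * (m * (k₁ * k₁ + k₂ * k₂ + k₃ * k₃ + k₄ * k₄))
        ≡ y₁ * y₁ + y₂ * y₂ + y₃ * y₃ + y₄ * y₄
      cancel = solve-∀

    m∣cofactor⇒m∣p : ∀ e → cofactor ≡ m * e →
      (∃ λ j → y₁ + y₁ ≡ m * j) → (∃ λ j → y₂ + y₂ ≡ m * j) →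
      (∃ λ j → y₃ + y₃ ≡ m * j) → (∃ λ j → y₄ + y₄ ≡ m * j) → ∃ λ z → p ≡ m * z
    m∣cofactor⇒m∣p e r≡ (j₁ , y₁≡) (j₂ , y₂≡) (j₃ , y₃≡) (j₄ , y₄≡) =
      e + (j₁ * k₁ + j₂ * k₂ + j₃ * k₃ + j₄ * k₄) + K , (begin
        p                       ≡⟨ restore p _ _ ⟩
        cofactor + A + m * K    ≡⟨ cong (λ t → t + A + m * K) r≡ ⟩
        m * e + A + m * K
          ≡⟨ cong (λ t → m * e + t + m * K)
               (cong₂ _+_ (cong₂ _+_ (cong₂ _+_ (cong (_* k₁) y₁≡) (cong (_* k₂) y₂≡)) (cong (_* k₃) y₃≡)) (cong (_* k₄) y₄≡)) ⟩
        m * e + (m * j₁ * k₁ + m * j₂ * k₂ + m * j₃ * k₃ + m * j₄ * k₄) + m * K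
          ≡⟨ factor m e K j₁ j₂ j₃ j₄ k₁ k₂ k₃ k₄ ⟩
        m * (e + (j₁ * k₁ + j₂ * k₂ + j₃ * k₃ + j₄ * k₄) + K) ∎)
      where
      open ≡-Reasoning
      A = (y₁ + y₁) * k₁ + (y₂ + y₂) * k₂ + (y₃ + y₃) * k₃ + (y₄ + y₄) * k₄
      K = k₁ * k₁ + k₂ * k₂ + k₃ * k₃ + k₄ * k₄
      restore : ∀ p a k → p ≡ p - a - k + a + k
      restore = solve-∀
      factor : ∀ m e k j₁ j₂ j₃ j₄ k₁ k₂ k₃ k₄ →
        m * e + (m * j₁ * k₁ + m * j₂ * k₂ + m * j₃ * k₃ + m * j₄ * k₄) + m * k
        ≡ m * (e + (j₁ * k₁ + j₂ * k₂ + j₃ * k₃ + j₄ * k₄) + k)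
      factor = solve-∀

  -- Lagrange's descent: reducing the four coordinates modulo `m` gives `m r = ∑ yᵢ²`, and Euler's
  -- identity divided by `m²` exhibits `r p` as a sum of four squares. The multiplier drops from `m`
  -- to `r` until it is 1.
  descent : ∀ {p} → Prime p → ∀ m → Acc ℕ._<_ m → 0 ℕ.< m → m ℕ.< p →
    SumOfFourSquares (+ m * + p) → SumOfFourSquares (+ p)
  descent {p} _ 1 _ _ _ = subst SumOfFourSquares (*-identityˡ (+ p))
  descent {p} p-prime m@(ℕ.suc (ℕ.suc _)) (acc rec) 0<m m<p (x₁ , x₂ , x₃ , x₄ , eq)
    with y₁ , k₁ , refl , 2y₁≤m ← balancedRemainder x₁ m
       | y₂ , k₂ , refl , 2y₂≤m ← balancedRemainder x₂ m
       | y₃ , k₃ , refl , 2y₃≤m ← balancedRemainder x₃ m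
       | y₄ , k₄ , refl , 2y₄≤m ← balancedRemainder x₄ m
    = byCofactor r refl
    where
    r = cofactor (+ m) (+ p) y₁ y₂ y₃ y₄ k₁ k₂ k₃ k₄
    N = ∣ y₁ ∣ ℕ.* ∣ y₁ ∣ ℕ.+ ∣ y₂ ∣ ℕ.* ∣ y₂ ∣ ℕ.+ ∣ y₃ ∣ ℕ.* ∣ y₃ ∣ ℕ.+ ∣ y₄ ∣ ℕ.* ∣ y₄ ∣
    mr≡ : + m * r ≡ y₁ * y₁ + y₂ * y₂ + y₃ * y₃ + y₄ * y₄
    mr≡ = m*cofactor (+ m) (+ p) y₁ y₂ y₃ y₄ k₁ k₂ k₃ k₄ eq
    mr≡+N : + m * r ≡ + N
    mr≡+N = trans mr≡ (cong₂ _+_ (cong₂ _+_ (cong₂ _+_ (i*i≡+∣i∣*∣i∣ y₁) (i*i≡+∣i∣*∣i∣ y₂)) (i*i≡+∣i∣*∣i∣ y₃)) (i*i≡+∣i∣*∣i∣ y₄))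
    -- Both extreme values of `r` end here in a contradiction, since `1 < m < p` and `p` is prime.
    p-multiple : ∀ e → r ≡ + m * e →
      (∃ λ j → y₁ + y₁ ≡ + m * j) → (∃ λ j → y₂ + y₂ ≡ + m * j) →
      (∃ λ j → y₃ + y₃ ≡ + m * j) → (∃ λ j → y₄ + y₄ ≡ + m * j) → SumOfFourSquares (+ p)
    p-multiple e r≡ h₁ h₂ h₃ h₄ =
      let z , p≡ = m∣cofactor⇒m∣p (+ m) (+ p) y₁ y₂ y₃ y₄ k₁ k₂ k₃ k₄ e r≡ h₁ h₂ h₃ h₄
      in contradiction p≡ (m∤p p-prime (s≤s (s≤s z≤n)) m<p z)
    smaller : ∀ {r′} → r ≡ + r′ → SumOfFourSquares (+ r′ * + p)
    smaller {r′} r≡ = w₁ , w₂ , w₃ , w₄ , *-cancelˡ-≡ (+ m * + m) _ _ {{i*j≢0 (+ m) (+ m)}} (begin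
      + m * + m * (+ r′ * + p)     ≡⟨ regroup (+ m) (+ r′) (+ p) ⟩
      (+ m * + p) * (+ m * + r′)   ≡⟨ cong (λ t → (+ m * + p) * (+ m * t)) (sym r≡) ⟩
      (+ m * + p) * (+ m * r)      ≡⟨ cong (_* (+ m * r)) eq ⟩
      _                            ≡⟨ euler-congruent (+ m) r y₁ y₂ y₃ y₄ k₁ k₂ k₃ k₄ mr≡ ⟩
      + m * + m * (w₁ * w₁ + w₂ * w₂ + w₃ * w₃ + w₄ * w₄) ∎)
      where
      open ≡-Reasoning
      w₁ = r + (k₁ * y₁ + k₂ * y₂ + k₃ * y₃ + k₄ * y₄)
      w₂ = k₁ * y₂ - k₂ * y₁ + k₃ * y₄ - k₄ * y₃
      w₃ = k₁ * y₃ - k₃ * y₁ + k₄ * y₂ - k₂ * y₄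
      w₄ = k₁ * y₄ - k₄ * y₁ + k₂ * y₃ - k₃ * y₂
      regroup : ∀ m r p → m * m * (r * p) ≡ (m * p) * (m * r)
      regroup = solve-∀
    byCofactor : ∀ r′ → r ≡ r′ → SumOfFourSquares (+ p)
    -- `m r` equals the natural number `N`, so `r` is not negative.
    byCofactor -[1+ n ] r≡ = contradiction (trans (cong (_*_ (+ m)) (sym r≡)) mr≡+N) λ ()
    -- For `r = 0` the sum `N` of four squares vanishes, hence so does every `yᵢ`.
    byCofactor (+ 0) r≡ = p-multiple 0ℤ (trans r≡ (sym (*-zeroʳ (+ m))))
      (∣y∣²≡0⇒m∣2y m y₁ (ℕ.m+n≡0⇒m≡0 _ (ℕ.m+n≡0⇒m≡0 _ (ℕ.m+n≡0⇒m≡0 _ N≡0))))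
      (∣y∣²≡0⇒m∣2y m y₂ (ℕ.m+n≡0⇒n≡0 (∣ y₁ ∣ ℕ.* ∣ y₁ ∣) (ℕ.m+n≡0⇒m≡0 _ (ℕ.m+n≡0⇒m≡0 _ N≡0))))
      (∣y∣²≡0⇒m∣2y m y₃ (ℕ.m+n≡0⇒n≡0 (∣ y₁ ∣ ℕ.* ∣ y₁ ∣ ℕ.+ ∣ y₂ ∣ ℕ.* ∣ y₂ ∣) (ℕ.m+n≡0⇒m≡0 _ N≡0)))
      (∣y∣²≡0⇒m∣2y m y₄ (ℕ.m+n≡0⇒n≡0 (∣ y₁ ∣ ℕ.* ∣ y₁ ∣ ℕ.+ ∣ y₂ ∣ ℕ.* ∣ y₂ ∣ ℕ.+ ∣ y₃ ∣ ℕ.* ∣ y₃ ∣) N≡0))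
      where
      N≡0 : N ≡ 0
      N≡0 = +-injective (trans (sym mr≡+N) (trans (cong (_*_ (+ m)) r≡) (*-zeroʳ (+ m))))
    byCofactor +[1+ n ] r≡ = byOrder (ℕ.m≤n⇒m<n∨m≡n (remainder-≤ (∣ y₁ ∣) (∣ y₂ ∣) (∣ y₃ ∣) (∣ y₄ ∣) 2y₁≤m 2y₂≤m 2y₃≤m 2y₄≤m mr′≡N))
      where
      mr′≡N : m ℕ.* ℕ.suc n ≡ N
      mr′≡N = +-injective (trans (pos-* m (ℕ.suc n)) (trans (cong (_*_ (+ m)) (sym r≡)) mr≡+N))
      byOrder : ℕ.suc n ℕ.< m ⊎ ℕ.suc n ≡ m → SumOfFourSquares (+ p)
      byOrder (inj₁ r<m) = descent p-prime (ℕ.suc n) (rec r<m) (s≤s z≤n) (ℕ.<-trans r<m m<p) (smaller r≡)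
      -- For `r = m` every `∣ yᵢ ∣` is exactly half of `m`.
      byOrder (inj₂ r≡m) =
        let (h₁ , h₂) , (h₃ , h₄) = remainder-max (∣ y₁ ∣) (∣ y₂ ∣) (∣ y₃ ∣) (∣ y₄ ∣) 2y₁≤m 2y₂≤m 2y₃≤m 2y₄≤m (trans (cong (m ℕ.*_) (sym r≡m)) mr′≡N)
        in p-multiple 1ℤ (trans r≡ (trans (cong +_ r≡m) (sym (*-identityʳ (+ m)))))
             (∣2y∣≡m⇒m∣2y y₁ h₁) (∣2y∣≡m⇒m∣2y y₂ h₂) (∣2y∣≡m⇒m∣2y y₃ h₃) (∣2y∣≡m⇒m∣2y y₄ h₄)

  -- A multiple of `p` of the form x² + y² + 1.

  ∤-positive : ∀ {p n} → 0 ℕ.< n → n ℕ.< p → ¬ p ∣ n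
  ∤-positive {n = ℕ.suc _} _ n<p p∣n = ℕ.<⇒≱ n<p (∣⇒≤ p∣n)

  %-≡⇒∣ : ∀ {p m} d .{{_ : NonZero p}} → m ℕ.% p ≡ (m ℕ.+ d) ℕ.% p → p ∣ d
  %-≡⇒∣ {p} {m} d eq = ∣m+n∣m⇒∣n (divides ((m ℕ.+ d) ℕ./ p) (ℕ.+-cancelˡ-≡ (m ℕ.% p) _ _ (begin
    m ℕ.% p ℕ.+ (m ℕ./ p ℕ.* p ℕ.+ d)      ≡⟨ ℕ.+-assoc (m ℕ.% p) _ d ⟨
    m ℕ.% p ℕ.+ m ℕ./ p ℕ.* p ℕ.+ d        ≡⟨ cong (ℕ._+ d) (m≡m%n+[m/n]*n m p) ⟨
    m ℕ.+ d                                ≡⟨ m≡m%n+[m/n]*n (m ℕ.+ d) p ⟩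
    (m ℕ.+ d) ℕ.% p ℕ.+ (m ℕ.+ d) ℕ./ p ℕ.* p  ≡⟨ cong (ℕ._+ (m ℕ.+ d) ℕ./ p ℕ.* p) eq ⟨
    m ℕ.% p ℕ.+ (m ℕ.+ d) ℕ./ p ℕ.* p      ∎))) (divides (m ℕ./ p) refl)
    where open ≡-Reasoning

  module _ {p : ℕ} (p-prime : Prime p) where

    private
      instance
        p-nonZero : NonZero p
        p-nonZero = prime⇒nonZero p-prime
      h = p ℕ./ 2
      1<p : 1 ℕ.< p
      1<p = ℕ.nonTrivial⇒n>1 p {{prime⇒nonTrivial p-prime}}
      h+h≤p : h ℕ.+ h ℕ.≤ p
      h+h≤p = ℕ.≤-trans (ℕ.≤-reflexive (double h)) (m/n*n≤m p 2)
        where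
        double : ∀ h → h ℕ.+ h ≡ h ℕ.* 2
        double = ℕSolver.solve-∀

      -- Otherwise `p` divides `(b - a) (b + a)`, so by Euclid's lemma it divides one factor. Both
      -- are positive and less than `p`: the first is at most `h < p`, the second is less than
      -- `2 h ≤ p`.
      squares-differ : ∀ {a b} → a ℕ.< b → b ℕ.≤ h → (a ℕ.* a) ℕ.% p ≢ (b ℕ.* b) ℕ.% p
      squares-differ {a} a<b b≤h eq with k , refl ← ℕ.m≤n⇒∃[o]m+o≡n a<b
        with euclidsLemma (ℕ.suc k) (a ℕ.+ (ℕ.suc a ℕ.+ k)) p-prime
               (%-≡⇒∣ _ (trans eq (cong (ℕ._% p) (difference a k))))
        where
        difference : ∀ a k → (ℕ.suc a ℕ.+ k) ℕ.* (ℕ.suc a ℕ.+ k)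
          ≡ a ℕ.* a ℕ.+ ℕ.suc k ℕ.* (a ℕ.+ (ℕ.suc a ℕ.+ k))
        difference = ℕSolver.solve-∀
      ... | inj₁ p∣b-a = ∤-positive (s≤s z≤n) (ℕ.≤-<-trans (ℕ.≤-trans (s≤s (ℕ.m≤n+m k a)) b≤h) h<p) p∣b-a
        where
        h<p : h ℕ.< p
        h<p = ℕ.<-≤-trans (ℕ.m<m+n h (ℕ.≤-trans (s≤s z≤n) b≤h)) h+h≤p
      ... | inj₂ p∣a+b = ∤-positive (ℕ.≤-trans (s≤s z≤n) (ℕ.m≤n+m _ a))
        (ℕ.<-≤-trans (ℕ.+-mono-<-≤ (ℕ.<-≤-trans a<b b≤h) b≤h) h+h≤p) p∣a+b

      square : Fin (ℕ.suc h) → Fin p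
      square x = (toℕ x ℕ.* toℕ x) mod p

      toℕ-square : ∀ x → toℕ (square x) ≡ (toℕ x ℕ.* toℕ x) ℕ.% p
      toℕ-square x = toℕ-fromℕ< _

      square-injective : ∀ {x y} → square x ≡ square y → x ≡ y
      square-injective {x} {y} eq with ℕ.<-cmp (toℕ x) (toℕ y)
        | trans (sym (toℕ-square x)) (trans (cong toℕ eq) (toℕ-square y))
      ... | tri< x<y _ _ | eq′ = contradiction eq′ (squares-differ x<y (ℕ.≤-pred (toℕ<n y)))
      ... | tri≈ _ x≡y _ | _   = toℕ-injective x≡y
      ... | tri> _ _ y<x | eq′ = contradiction (sym eq′) (squares-differ y<x (ℕ.≤-pred (toℕ<n x)))

      opposite-injective : ∀ {x y : Fin p} → opposite x ≡ opposite y → x ≡ y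
      opposite-injective eq = trans (sym (opposite-involutive _)) (trans (cong opposite eq) (opposite-involutive _))

      -- opposite sends the residue of t to that of -1 - t.
      opposite-square : ∀ x y → square x ≡ opposite (square y) →
        p ∣ toℕ x ℕ.* toℕ x ℕ.+ toℕ y ℕ.* toℕ y ℕ.+ 1
      opposite-square x y eq = divides (ℕ.suc (X ℕ./ p ℕ.+ Y ℕ./ p)) (begin
        X ℕ.+ Y ℕ.+ 1
          ≡⟨ cong₂ (λ s t → s ℕ.+ t ℕ.+ 1) (m≡m%n+[m/n]*n X p) (m≡m%n+[m/n]*n Y p) ⟩
        (X ℕ.% p ℕ.+ X ℕ./ p ℕ.* p) ℕ.+ (Y ℕ.% p ℕ.+ Y ℕ./ p ℕ.* p) ℕ.+ 1
          ≡⟨ regroup (X ℕ.% p) (Y ℕ.% p) (X ℕ./ p) (Y ℕ./ p) p ⟩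
        X ℕ.% p ℕ.+ ℕ.suc (Y ℕ.% p) ℕ.+ (X ℕ./ p ℕ.+ Y ℕ./ p) ℕ.* p
          ≡⟨ cong (ℕ._+ (X ℕ./ p ℕ.+ Y ℕ./ p) ℕ.* p) complementary ⟩
        ℕ.suc (X ℕ./ p ℕ.+ Y ℕ./ p) ℕ.* p ∎)
        where
        open ≡-Reasoning
        X = toℕ x ℕ.* toℕ x
        Y = toℕ y ℕ.* toℕ y
        regroup : ∀ r s u v p → (r ℕ.+ u ℕ.* p) ℕ.+ (s ℕ.+ v ℕ.* p) ℕ.+ 1
          ≡ r ℕ.+ ℕ.suc s ℕ.+ (u ℕ.+ v) ℕ.* p
        regroup = ℕSolver.solve-∀
        complementary : X ℕ.% p ℕ.+ ℕ.suc (Y ℕ.% p) ≡ p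
        complementary = begin
          X ℕ.% p ℕ.+ ℕ.suc (Y ℕ.% p)           ≡⟨ cong (ℕ._+ ℕ.suc (Y ℕ.% p)) (toℕ-square x) ⟨
          toℕ (square x) ℕ.+ ℕ.suc (Y ℕ.% p)    ≡⟨ cong (λ t → toℕ t ℕ.+ ℕ.suc (Y ℕ.% p)) eq ⟩
          toℕ (opposite (square y)) ℕ.+ ℕ.suc (Y ℕ.% p)
            ≡⟨ cong₂ (λ s t → s ℕ.+ ℕ.suc t) (opposite-prop (square y)) (sym (toℕ-square y)) ⟩
          p ℕ.∸ ℕ.suc (toℕ (square y)) ℕ.+ ℕ.suc (toℕ (square y)) ≡⟨ ℕ.m∸n+n≡m (toℕ<n (square y)) ⟩
          p ∎

      p<squares : p ℕ.< ℕ.suc h ℕ.+ ℕ.suc h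
      p<squares = begin-strict
        p                       ≡⟨ m≡m%n+[m/n]*n p 2 ⟩
        p ℕ.% 2 ℕ.+ h ℕ.* 2     <⟨ ℕ.+-monoˡ-< (h ℕ.* 2) (m%n<n p 2) ⟩
        2 ℕ.+ h ℕ.* 2           ≡⟨ double h ⟩
        ℕ.suc h ℕ.+ ℕ.suc h     ∎
        where
        open ℕ.≤-Reasoning
        double : ∀ h → 2 ℕ.+ h ℕ.* 2 ≡ ℕ.suc h ℕ.+ ℕ.suc h
        double = ℕSolver.solve-∀

      residue : Fin (ℕ.suc h) ⊎ Fin (ℕ.suc h) → Fin p
      residue = [ square , opposite ∘ square ]′

      coincidence : ∀ x y → x ≢ y → residue x ≡ residue y →
        ∃₂ λ (u v : Fin (ℕ.suc h)) → p ∣ toℕ u ℕ.* toℕ u ℕ.+ toℕ v ℕ.* toℕ v ℕ.+ 1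
      coincidence (inj₁ x) (inj₁ y) x≢y eq = contradiction (cong inj₁ (square-injective eq)) x≢y
      coincidence (inj₁ x) (inj₂ y) x≢y eq = x , y , opposite-square x y eq
      coincidence (inj₂ x) (inj₁ y) x≢y eq = y , x , opposite-square y x (sym eq)
      coincidence (inj₂ x) (inj₂ y) x≢y eq =
        contradiction (cong inj₂ (square-injective (opposite-injective eq))) x≢y

      -- The `h + 1` residues of x² are distinct, as are the `h + 1` residues of -1 - y². Counting
      -- 0, these are `2 (h + 1) > p` values in `Fin p`, so a residue of the first kind meets one of
      -- the second.
      x²+y²+1 : ∃₂ λ (x y : Fin (ℕ.suc h)) → p ∣ toℕ x ℕ.* toℕ x ℕ.+ toℕ y ℕ.* toℕ y ℕ.+ 1
      x²+y²+1 with i , j , i<j , eq ← pigeonhole p<squares (residue ∘ splitAt (ℕ.suc h))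
        = coincidence (splitAt (ℕ.suc h) i) (splitAt (ℕ.suc h) j) i≢j eq
        where
        i≢j : splitAt (ℕ.suc h) i ≢ splitAt (ℕ.suc h) j
        i≢j split≡ = ℕ.<⇒≢ i<j (cong toℕ (trans (sym (join-splitAt (ℕ.suc h) (ℕ.suc h) i))
          (trans (cong (join (ℕ.suc h) (ℕ.suc h)) split≡) (join-splitAt (ℕ.suc h) (ℕ.suc h) j))))

      -- Ensures that the initial multiplier of the descent is less than `p`: the double of the left
      -- side is at most `(2 h)² + 2 ≤ p² + 2 < 2 p²`.
      x²+y²+1<p*p : ∀ {x y} → x ℕ.≤ h → y ℕ.≤ h → x ℕ.* x ℕ.+ y ℕ.* y ℕ.+ 1 ℕ.< p ℕ.* p
      x²+y²+1<p*p {x} {y} x≤h y≤h = ℕ.*-cancelˡ-< 2 _ _ (begin-strict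
        2 ℕ.* (x ℕ.* x ℕ.+ y ℕ.* y ℕ.+ 1)
          ≤⟨ ℕ.*-monoʳ-≤ 2 (ℕ.+-monoˡ-≤ 1 (ℕ.+-mono-≤ (ℕ.*-mono-≤ x≤h x≤h) (ℕ.*-mono-≤ y≤h y≤h))) ⟩
        2 ℕ.* (h ℕ.* h ℕ.+ h ℕ.* h ℕ.+ 1)   ≡⟨ regroup h ⟩
        (h ℕ.+ h) ℕ.* (h ℕ.+ h) ℕ.+ 2       ≤⟨ ℕ.+-monoˡ-≤ 2 (ℕ.*-mono-≤ h+h≤p h+h≤p) ⟩
        p ℕ.* p ℕ.+ 2                       <⟨ ℕ.+-monoʳ-< (p ℕ.* p) 2<p*p ⟩
        p ℕ.* p ℕ.+ p ℕ.* p                 ≡⟨ cong (p ℕ.* p ℕ.+_) (ℕ.+-identityʳ _) ⟨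
        2 ℕ.* (p ℕ.* p)                     ∎)
        where
        open ℕ.≤-Reasoning
        2<p*p : 2 ℕ.< p ℕ.* p
        2<p*p = ℕ.≤-trans (s≤s (s≤s (s≤s z≤n))) (ℕ.*-mono-≤ 1<p 1<p)
        regroup : ∀ h → 2 ℕ.* (h ℕ.* h ℕ.+ h ℕ.* h ℕ.+ 1) ≡ (h ℕ.+ h) ℕ.* (h ℕ.+ h) ℕ.+ 2
        regroup = ℕSolver.solve-∀

    -- The descent starts from `m p = x² + y² + 1² + 0²`; here `m` is not 0 because the right side
    -- is positive.
    prime-sumOfFourSquares : SumOfFourSquares (+ p)
    prime-sumOfFourSquares with x , y , divides m eq ← x²+y²+1 =
      descent p-prime m (<-wellFounded m) (0<m m eq)
        (ℕ.*-cancelʳ-< p m p (subst (ℕ._< p ℕ.* p) eq (x²+y²+1<p*p (ℕ.≤-pred (toℕ<n x)) (ℕ.≤-pred (toℕ<n y)))))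
        (+ toℕ x , + toℕ y , 1ℤ , 0ℤ , (begin
          + m * + p                                                ≡⟨ pos-* m p ⟨
          + (m ℕ.* p)                                              ≡⟨ cong +_ eq ⟨
          + (toℕ x ℕ.* toℕ x) + + (toℕ y ℕ.* toℕ y) + 1ℤ
            ≡⟨ cong₂ (λ s t → s + t + 1ℤ) (pos-* (toℕ x) (toℕ x)) (pos-* (toℕ y) (toℕ y)) ⟩
          + toℕ x * + toℕ x + + toℕ y * + toℕ y + 1ℤ               ≡⟨ +-identityʳ _ ⟨
          + toℕ x * + toℕ x + + toℕ y * + toℕ y + 1ℤ + 0ℤ          ∎))
      where
      open ≡-Reasoning
      0<m : ∀ m {s} → s ℕ.+ 1 ≡ m ℕ.* p → 0 ℕ.< m
      0<m ℕ.zero    {s} eq = contradiction (trans (ℕ.+-comm 1 s) eq) λ ()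
      0<m (ℕ.suc _) eq = s≤s z≤n

  -- Lagrange's theorem from prime factorisation.

  product-sumOfFourSquares : ∀ {ps} → All Prime ps → SumOfFourSquares (+ product ps)
  product-sumOfFourSquares [] = 1ℤ , 0ℤ , 0ℤ , 0ℤ , refl
  product-sumOfFourSquares {p ∷ ps} (p-prime ∷ ps-prime) = subst SumOfFourSquares (sym (pos-* p (product ps)))
    (*-sumOfFourSquares (prime-sumOfFourSquares p-prime) (product-sumOfFourSquares ps-prime))

  lagrange : ∀ n → SumOfFourSquares (+ n)
  lagrange ℕ.zero = 0ℤ , 0ℤ , 0ℤ , 0ℤ , refl
  lagrange n@(ℕ.suc _) = subst (SumOfFourSquares ∘ +_) (sym isFactorisation) (product-sumOfFourSquares factorsPrime)
    where open PrimeFactorisation (factorise n)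

module Lattices where

  open FourSquares using (lagrange; i*i≡+∣i∣*∣i∣; m*m≡n*n⇒m≡n)
  open import Data.Nat using (ℕ; z≤n; s≤s)
  open import Data.Nat.DivMod using (m<n*o⇒m/o<n; m≡m%n+[m/n]*n; m%n<n)
  open import Data.Fin using (Fin; zero; suc; toℕ; fromℕ<; splitAt; _↑ˡ_; _↑ʳ_)
  open import Data.Fin.Properties using (toℕ-fromℕ<)
  open import Data.Integer hiding (suc)
  open import Data.Integer.Properties
  open import Data.Integer.Tactic.RingSolver using (solve-∀)
  open import Data.Vec.Functional using ([]; _∷_; _++_)
  open import Data.Vec.Functional.Properties using (lookup-++ˡ; lookup-++ʳ)

  -- Finite sums.

  ∑-cong : ∀ {r} {f g : Fin r → ℤ} → (∀ i → f i ≡ g i) → ∑ f ≡ ∑ g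
  ∑-cong {ℕ.zero}  _   = refl
  ∑-cong {ℕ.suc r} f≗g = cong₂ _+_ (f≗g zero) (∑-cong (f≗g ∘ suc))

  ∑-+ : ∀ {r} (f g : Fin r → ℤ) → ∑ (λ i → f i + g i) ≡ ∑ f + ∑ g
  ∑-+ {ℕ.zero}  f g = refl
  ∑-+ {ℕ.suc r} f g = trans (cong (_+_ (f zero + g zero)) (∑-+ (f ∘ suc) (g ∘ suc)))
    (interchange (f zero) (g zero) _ _)
    where
    interchange : ∀ a b c d → a + b + (c + d) ≡ a + c + (b + d)
    interchange = solve-∀

  ∑-*ˡ : ∀ {r} c (f : Fin r → ℤ) → ∑ (λ i → c * f i) ≡ c * ∑ f
  ∑-*ˡ {ℕ.zero}  c f = sym (*-zeroʳ c)
  ∑-*ˡ {ℕ.suc r} c f = trans (cong (_+_ (c * f zero)) (∑-*ˡ c (f ∘ suc)))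
    (sym (*-distribˡ-+ c (f zero) (∑ (f ∘ suc))))

  ∑-zero : ∀ {r} {f : Fin r → ℤ} → (∀ i → f i ≡ 0ℤ) → ∑ f ≡ 0ℤ
  ∑-zero {ℕ.zero}  _   = refl
  ∑-zero {ℕ.suc r} f≗0 = cong₂ _+_ (f≗0 zero) (∑-zero (f≗0 ∘ suc))

  ∑-mono-≤ : ∀ {r} {f g : Fin r → ℤ} → (∀ i → f i ≤ g i) → ∑ f ≤ ∑ g
  ∑-mono-≤ {ℕ.zero}  _   = ≤-refl
  ∑-mono-≤ {ℕ.suc r} f≤g = +-mono-≤ (f≤g zero) (∑-mono-≤ (f≤g ∘ suc))

  ∑-split : ∀ m {n} (f : Fin (m ℕ.+ n) → ℤ) → ∑ f ≡ ∑ (f ∘ (_↑ˡ n)) + ∑ (f ∘ (m ↑ʳ_))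
  ∑-split ℕ.zero    f = sym (+-identityˡ _)
  ∑-split (ℕ.suc m) f = trans (cong (_+_ (f zero)) (∑-split m (f ∘ suc))) (sym (+-assoc (f zero) _ _))

  ∑-++ : ∀ {m n} (f : Fin m → ℤ) (g : Fin n → ℤ) → ∑ (f ++ g) ≡ ∑ f + ∑ g
  ∑-++ {m} f g = trans (∑-split m (f ++ g)) (cong₂ _+_ (∑-cong (lookup-++ˡ f g)) (∑-cong (lookup-++ʳ f g)))

  -- Diagonal forms and rank-one updates.

  weightedSquares : ∀ {r} → (Fin r → ℤ) → (Fin r → ℤ) → ℤ
  weightedSquares d x = ∑ (λ i → d i * (x i * x i))

  weightedSquares-++ : ∀ {m n} (d : Fin m → ℕ) (e : Fin n → ℕ) (x : Fin m → ℤ) (y : Fin n → ℤ) →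
    weightedSquares (+_ ∘ (d ++ e)) (x ++ y) ≡ weightedSquares (+_ ∘ d) x + weightedSquares (+_ ∘ e) y
  weightedSquares-++ {m} d e x y = trans (∑-split m _) (cong₂ _+_
    (∑-cong (λ i → cong₂ (λ a b → + a * (b * b)) (lookup-++ˡ d e i) (lookup-++ˡ x y i)))
    (∑-cong (λ i → cong₂ (λ a b → + a * (b * b)) (lookup-++ʳ d e i) (lookup-++ʳ x y i))))

  single : ∀ {r} → Fin r → ℤ → Fin r → ℤ
  single zero    c = c ∷ λ _ → 0ℤ
  single (suc i) c = 0ℤ ∷ single i c

  ∑-single : ∀ {r} (i : Fin r) c → ∑ (single i c) ≡ c
  ∑-single {ℕ.suc r} zero c = trans (cong (_+_ c) (∑-zero {r} λ _ → refl)) (+-identityʳ c)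
  ∑-single (suc i) c = trans (+-identityˡ _) (∑-single i c)

  weightedSquares-zero : ∀ {r} (d : Fin r → ℤ) → weightedSquares d (λ _ → 0ℤ) ≡ 0ℤ
  weightedSquares-zero d = ∑-zero (λ i → *-zeroʳ (d i))

  weightedSquares-single : ∀ {r} (d : Fin r → ℤ) i c → weightedSquares d (single i c) ≡ d i * (c * c)
  weightedSquares-single {ℕ.suc r} d zero c =
    trans (cong (_+_ (d zero * (c * c))) (weightedSquares-zero (d ∘ suc))) (+-identityʳ _)
  weightedSquares-single d (suc i) c =
    trans (cong₂ _+_ (*-zeroʳ (d zero)) (weightedSquares-single (d ∘ suc) i c)) (+-identityˡ _)

  -- Recursion on both indices, without an equality test, lets the form be evaluated by induction on
  -- the rank.
  diagonal : ∀ {r} → (Fin r → ℤ) → Gram r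
  diagonal d zero    zero    = d zero
  diagonal d zero    (suc j) = 0ℤ
  diagonal d (suc i) zero    = 0ℤ
  diagonal d (suc i) (suc j) = diagonal (d ∘ suc) i j

  diagonal-symmetric : ∀ {r} (d : Fin r → ℤ) → Symmetric (diagonal d)
  diagonal-symmetric d zero    zero    = refl
  diagonal-symmetric d zero    (suc j) = refl
  diagonal-symmetric d (suc i) zero    = refl
  diagonal-symmetric d (suc i) (suc j) = diagonal-symmetric (d ∘ suc) i j

  Q-diagonal : ∀ {r} (d x : Fin r → ℤ) → Q (diagonal d) x ≡ weightedSquares d x
  Q-diagonal {ℕ.zero}  d x = refl
  Q-diagonal {ℕ.suc r} d x = cong₂ _+_
    (trans (cong (_+_ (x zero * d zero * x zero))
      (∑-zero {f = λ j → x zero * 0ℤ * x (suc j)} λ j → vanish (x zero) (x (suc j)))) (reorder (x zero) (d zero)))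
    (trans (∑-cong {g = λ i → ∑ (λ j → x (suc i) * diagonal (d ∘ suc) i j * x (suc j))} λ i →
        trans (cong (_+ ∑ (λ j → x (suc i) * diagonal (d ∘ suc) i j * x (suc j))) (vanish (x (suc i)) (x zero)))
          (+-identityˡ _))
      (Q-diagonal (d ∘ suc) (x ∘ suc)))
    where
    vanish : ∀ a b → a * 0ℤ * b ≡ 0ℤ
    vanish = solve-∀
    reorder : ∀ a b → a * b * a + 0ℤ ≡ b * (a * a)
    reorder = solve-∀

  -- A rank-one update: `h` times the square of the linear form with coefficients `u` is added to
  -- the quadratic form. It serves for a coordinate of the ambient diagonal lattice that is only a
  -- linear form in the chosen basis.
  _+[_]_² : ∀ {r} → Gram r → ℤ → (Fin r → ℤ) → Gram r
  (G +[ h ] u ²) i j = G i j + h * (u i * u j)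

  Q-+[]² : ∀ {r} (G : Gram r) h (u x : Fin r → ℤ) →
    let s = ∑ (λ i → u i * x i) in Q (G +[ h ] u ²) x ≡ Q G x + h * (s * s)
  Q-+[]² G h u x = begin
    Q (G +[ h ] u ²) x
      ≡⟨ ∑-cong (λ i → ∑-cong (λ j → expand (x i) (G i j) h (u i) (u j) (x j))) ⟩
    ∑ (λ i → ∑ (λ j → x i * G i j * x j + h * (u i * x i) * (u j * x j)))
      ≡⟨ ∑-cong (λ i → trans (∑-+ (λ j → x i * G i j * x j) (λ j → h * (u i * x i) * (u j * x j)))
           (cong (_+_ (∑ (λ j → x i * G i j * x j)))
             (trans (∑-*ˡ (h * (u i * x i)) (λ j → u j * x j)) (rotate h (u i * x i) s)))) ⟩
    ∑ (λ i → ∑ (λ j → x i * G i j * x j) + h * s * (u i * x i))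
      ≡⟨ ∑-+ (λ i → ∑ (λ j → x i * G i j * x j)) (λ i → h * s * (u i * x i)) ⟩
    Q G x + ∑ (λ i → h * s * (u i * x i))
      ≡⟨ cong (_+_ (Q G x)) (trans (∑-*ˡ (h * s) (λ i → u i * x i)) (*-assoc h s s)) ⟩
    Q G x + h * (s * s) ∎
    where
    open ≡-Reasoning
    s = ∑ (λ i → u i * x i)
    expand : ∀ x g h u v y → x * (g + h * (u * v)) * y ≡ x * g * y + h * (u * x) * (v * y)
    expand = solve-∀
    rotate : ∀ h a s → h * a * s ≡ h * s * a
    rotate = solve-∀

  -- Definiteness and parity of sums of squares.

  ∑-squares-definite : ∀ {r} (z : Fin r → ℤ) →
    ∃ λ a → ∑ (λ i → z i * z i) ≡ + a × (a ≡ 0 → ∀ i → z i ≡ 0ℤ)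
  ∑-squares-definite {ℕ.zero}  z = 0 , refl , λ _ ()
  ∑-squares-definite {ℕ.suc r} z with a , eq , definite ← ∑-squares-definite (z ∘ suc) =
    ∣ z zero ∣ ℕ.* ∣ z zero ∣ ℕ.+ a , cong₂ _+_ (i*i≡+∣i∣*∣i∣ (z zero)) eq , λ where
      a≡0 zero    → ∣i∣≡0⇒i≡0 (m*m≡n*n⇒m≡n (ℕ.m+n≡0⇒m≡0 _ a≡0))
      a≡0 (suc i) → definite (ℕ.m+n≡0⇒n≡0 (∣ z zero ∣ ℕ.* ∣ z zero ∣) a≡0) i

  n*n+n-even : ∀ n → ∃ λ t → + n * + n + + n ≡ t + t
  n*n+n-even ℕ.zero  = 0ℤ , refl
  n*n+n-even (ℕ.suc n) with t , eq ← n*n+n-even n =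
    t + (1ℤ + + n) , trans (step (+ n)) (trans (cong (_+ (1ℤ + + n + (1ℤ + + n))) eq) (regroup t (1ℤ + + n)))
    where
    step : ∀ a → (1ℤ + a) * (1ℤ + a) + (1ℤ + a) ≡ a * a + a + (1ℤ + a + (1ℤ + a))
    step = solve-∀
    regroup : ∀ t a → t + t + (a + a) ≡ t + a + (t + a)
    regroup = solve-∀

  i*i+i-even : ∀ i → ∃ λ t → i * i + i ≡ t + t
  i*i+i-even (+ n)    = n*n+n-even n
  -- For `i = -(1 + n)` the product `i (i + 1)` is again `n (n + 1)`.
  i*i+i-even -[1+ n ] with t , eq ← n*n+n-even n = t , trans (reflect (+ n)) eq
    where
    reflect : ∀ a → (- (1ℤ + a)) * (- (1ℤ + a)) + (- (1ℤ + a)) ≡ a * a + a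
    reflect = solve-∀

  -- Each square has the parity of its base. Consequently a tail with square sum 1 has an odd
  -- coordinate sum, which forces an odd head coordinate.
  ∑-squares-parity : ∀ {r} (z : Fin r → ℤ) → ∃ λ t → ∑ (λ i → z i * z i) + ∑ z ≡ t + t
  ∑-squares-parity {ℕ.zero}  z = 0ℤ , refl
  ∑-squares-parity {ℕ.suc r} z
    with t , eq ← ∑-squares-parity (z ∘ suc) | t₀ , eq₀ ← i*i+i-even (z zero)
    = t₀ + t , trans (interchange (z zero * z zero) _ (z zero) _) (trans (cong₂ _+_ eq₀ eq) (interchange t₀ t₀ t t))
    where
    interchange : ∀ a b c d → a + b + (c + d) ≡ a + c + (b + d)
    interchange = solve-∀

  i+i+1≢0 : ∀ i → i + i + 1ℤ ≢ 0ℤ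
  i+i+1≢0 (+ n) eq = contradiction (trans (ℕ.+-comm 1 (n ℕ.+ n)) (+-injective eq)) λ ()
  i+i+1≢0 -[1+ n ] ()

  -- Coordinates (x₁ , … , x₄ , z₀ , z): the x's carry n times the sum of four squares, and (z₀ , z) is
  -- the vector of the diagonal lattice with tail z and head 2 z₀ - ∑ z, whose coordinate sum is 2 z₀.
  -- The head has norm h and the tail coordinates have norms d i ≥ h′.
  module EvenSublattice (n h h′ g : ℕ) {k : ℕ} (d : Fin k → ℕ) where

    -- The Gram matrix and its quadratic form.

    weights functional : Fin (5 ℕ.+ k) → ℤ
    weights    = + n ∷ + n ∷ + n ∷ + n ∷ + g ∷ (+_ ∘ d)
    functional = 0ℤ ∷ 0ℤ ∷ 0ℤ ∷ 0ℤ ∷ + 2 ∷ λ _ → -1ℤ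

    gram : Gram (5 ℕ.+ k)
    gram = diagonal weights +[ + h ] functional ²

    core : ℤ → (Fin k → ℤ) → ℤ
    core z₀ z = + g * (z₀ * z₀) + weightedSquares (+_ ∘ d) z + + h * ((z₀ + z₀ - ∑ z) * (z₀ + z₀ - ∑ z))

    Q-gram : ∀ x → let z = λ i → x (suc (suc (suc (suc (suc i))))) in
      Q gram x ≡ + n * ∑ {4} (λ i → x (i ↑ˡ ℕ.suc k) * x (i ↑ˡ ℕ.suc k)) + core (x (4 ↑ʳ zero)) z
    Q-gram x = begin
      Q gram x
        ≡⟨ Q-+[]² (diagonal weights) (+ h) functional x ⟩
      Q (diagonal weights) x + + h * (ℓ * ℓ)
        ≡⟨ cong₂ (λ a b → a + + h * (b * b)) (Q-diagonal weights x) linear ⟩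
      weightedSquares weights x + + h * (w * w)
        ≡⟨ regroup (+ n) (+ g) (x zero) (x (suc zero)) (x (suc (suc zero))) (x (suc (suc (suc zero)))) z₀
             (weightedSquares (+_ ∘ d) z) (+ h * (w * w)) ⟩
      + n * ∑ {4} (λ i → x (i ↑ˡ ℕ.suc k) * x (i ↑ˡ ℕ.suc k)) + core z₀ z ∎
      where
      open ≡-Reasoning
      z₀ = x (4 ↑ʳ zero)
      z = λ i → x (suc (suc (suc (suc (suc i)))))
      w = z₀ + z₀ - ∑ z
      ℓ = ∑ (λ i → functional i * x i)
      drop : ∀ a b c d e s → 0ℤ * a + (0ℤ * b + (0ℤ * c + (0ℤ * d + (+ 2 * e + -1ℤ * s)))) ≡ e + e - s
      drop = solve-∀
      linear : ℓ ≡ w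
      linear = trans (cong (λ t → 0ℤ * x zero + (0ℤ * x (suc zero) + (0ℤ * x (suc (suc zero))
          + (0ℤ * x (suc (suc (suc zero))) + (+ 2 * z₀ + t))))) (∑-*ˡ -1ℤ z))
        (drop (x zero) (x (suc zero)) (x (suc (suc zero))) (x (suc (suc (suc zero)))) z₀ (∑ z))
      regroup : ∀ n g a b c d e s t →
        n * (a * a) + (n * (b * b) + (n * (c * c) + (n * (d * d) + (g * (e * e) + s)))) + t
        ≡ n * (a * a + (b * b + (c * c + (d * d + 0ℤ)))) + (g * (e * e) + s + t)
      regroup = solve-∀

    gram-symmetric : Symmetric gram
    gram-symmetric i j = cong₂ (λ a b → a + + h * b) (diagonal-symmetric weights i j) (*-comm (functional i) (functional j))

    -- The minimum of the lattice.

    module _ (0<n : 0 ℕ.< n) (n≤h+h′ : n ℕ.≤ h ℕ.+ h′) (n≤2h′ : n ℕ.≤ h′ ℕ.+ h′) (n≤4h : n ℕ.≤ h ℕ.* 4)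
      (h′≤d : ∀ i → h′ ℕ.≤ d i) where

      -- With `a` the square sum of the tail and `w` the head, the value is at least `h′ a + h w²`.
      -- If `a = 0`, then `w = 2 z₀` and a nonzero vector has value at least `4 h`. If `a = 1`, then
      -- `w` is odd and the value is at least `h′ + h`. If `a ≥ 2`, it is at least `2 h′`. The
      -- hypotheses bound `n` by each of the three.
      core-bound : ∀ z₀ z → ∃ λ c → + c ≤ core z₀ z × ((z₀ ≡ 0ℤ × ∀ i → z i ≡ 0ℤ) ⊎ n ℕ.≤ c)
      core-bound z₀ z
        with a , ∑≡a , definite ← ∑-squares-definite z
           | t , ∑+∑≡2t ← ∑-squares-parity z
        = h′ ℕ.* a ℕ.+ h ℕ.* b , lower , cases a refl
        where
        w = z₀ + z₀ - ∑ z
        b = ∣ w ∣ ℕ.* ∣ w ∣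
        lower : + (h′ ℕ.* a ℕ.+ h ℕ.* b) ≤ core z₀ z
        -- Every tail weight is lowered to `h′`, and the nonnegative term `g z₀²` is discarded.
        lower = +-mono-≤ (begin
          + (h′ ℕ.* a)                                   ≡⟨ pos-* h′ a ⟩
          + h′ * + a                                     ≡⟨ cong (_*_ (+ h′)) ∑≡a ⟨
          + h′ * ∑ (λ i → z i * z i)                     ≡⟨ ∑-*ˡ (+ h′) (λ i → z i * z i) ⟨
          ∑ (λ i → + h′ * (z i * z i))                   ≤⟨ ∑-mono-≤ term ⟩
          weightedSquares (+_ ∘ d) z                     ≡⟨ +-identityˡ _ ⟨
          0ℤ + weightedSquares (+_ ∘ d) z                ≤⟨ +-monoˡ-≤ _ nonneg ⟩
          + g * (z₀ * z₀) + weightedSquares (+_ ∘ d) z   ∎)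
          (≤-reflexive (trans (pos-* h b) (cong (_*_ (+ h)) (sym (i*i≡+∣i∣*∣i∣ w)))))
          where
          open ≤-Reasoning
          term : ∀ i → + h′ * (z i * z i) ≤ + d i * (z i * z i)
          term i rewrite i*i≡+∣i∣*∣i∣ (z i) = *-monoʳ-≤-nonNeg (+ (∣ z i ∣ ℕ.* ∣ z i ∣)) (+≤+ (h′≤d i))
          nonneg : 0ℤ ≤ + g * (z₀ * z₀)
          nonneg rewrite i*i≡+∣i∣*∣i∣ z₀ | sym (pos-* g (∣ z₀ ∣ ℕ.* ∣ z₀ ∣)) = +≤+ z≤n
        odd : a ≡ 1 → w ≢ 0ℤ
        -- By parity `1 + ∑ z = 2 t`, so `w = 0` would give `2 (z₀ - t) + 1 = 0`.
        odd refl w≡0 = i+i+1≢0 (z₀ - t) (trans (regroup z₀ t) (trans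
          (cong (λ s → z₀ + z₀ - s + 1ℤ) (sym ∑+∑≡2t))
          (trans (cong (λ s → z₀ + z₀ - (s + ∑ z) + 1ℤ) ∑≡a) (trans (cancel z₀ (∑ z)) w≡0))))
          where
          regroup : ∀ u t → u - t + (u - t) + 1ℤ ≡ u + u - (t + t) + 1ℤ
          regroup = solve-∀
          cancel : ∀ u s → u + u - (1ℤ + s) + 1ℤ ≡ u + u - s
          cancel = solve-∀
        w≡2z₀ : a ≡ 0 → w ≡ z₀ + z₀
        w≡2z₀ a≡0 = trans (cong (λ s → z₀ + z₀ - s) (∑-zero (definite a≡0))) (+-identityʳ _)
        cases : ∀ a′ → a ≡ a′ → (z₀ ≡ 0ℤ × ∀ i → z i ≡ 0ℤ) ⊎ n ℕ.≤ h′ ℕ.* a ℕ.+ h ℕ.* b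
        cases 0 a≡0 with z₀ ≟ 0ℤ
        ... | yes z₀≡0 = inj₁ (z₀≡0 , definite a≡0)
        ... | no  z₀≢0 = inj₂ (ℕ.≤-trans n≤4h (ℕ.≤-trans (ℕ.*-monoʳ-≤ h 4≤b) (ℕ.m≤n+m _ _)))
          where
          2≤∣w∣ : 2 ℕ.≤ ∣ w ∣
          2≤∣w∣ rewrite w≡2z₀ a≡0 = double-≥2 z₀ z₀≢0
            where
            double-≥2 : ∀ i → i ≢ 0ℤ → 2 ℕ.≤ ∣ i + i ∣
            double-≥2 (+ ℕ.zero)  i≢0 = contradiction refl i≢0
            double-≥2 (+ ℕ.suc m) _   = s≤s (ℕ.≤-trans (s≤s z≤n) (ℕ.m≤n+m (ℕ.suc m) m))
            double-≥2 -[1+ m ]    _   = s≤s (s≤s z≤n)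
          4≤b : 4 ℕ.≤ b
          4≤b = ℕ.*-mono-≤ 2≤∣w∣ 2≤∣w∣
        cases 1 a≡1 = inj₂ (ℕ.≤-trans n≤h+h′ (ℕ.≤-trans (ℕ.≤-reflexive (ℕ.+-comm h h′))
          (ℕ.+-mono-≤ (ℕ.≤-reflexive (trans (sym (ℕ.*-identityʳ h′)) (cong (ℕ._*_ h′) (sym a≡1))))
            (ℕ.≤-trans (ℕ.≤-reflexive (sym (ℕ.*-identityʳ h))) (ℕ.*-monoʳ-≤ h 1≤b)))))
          where
          1≤∣w∣ : 1 ℕ.≤ ∣ w ∣
          1≤∣w∣ = ℕ.n≢0⇒n>0 (odd a≡1 ∘ ∣i∣≡0⇒i≡0)
          1≤b : 1 ℕ.≤ b
          1≤b = ℕ.*-mono-≤ 1≤∣w∣ 1≤∣w∣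
        cases (ℕ.suc (ℕ.suc a′)) a≡ = inj₂ (ℕ.≤-trans n≤2h′ (ℕ.≤-trans
          (ℕ.≤-trans (ℕ.≤-reflexive (trans (cong (ℕ._+_ h′) (sym (ℕ.+-identityʳ h′))) (ℕ.*-comm 2 h′)))
            (ℕ.*-monoʳ-≤ h′ (subst (2 ℕ.≤_) (sym a≡) (s≤s (s≤s z≤n)))))
          (ℕ.m≤m+n _ _)))

      -- The two summands are orthogonal, so the value is at least `n a + c`, where `a` is the sum
      -- of the four squares. It suffices that `a > 0`; for `a = 0` the bound `c` on the other
      -- summand decides.
      minimum : ∀ x → (∀ i → x i ≡ 0ℤ) ⊎ + n ≤ Q gram x
      minimum x
        with a , ∑≡a , definite ← ∑-squares-definite {4} (λ i → x (i ↑ˡ ℕ.suc k))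
           | c , c≤core , bound ← core-bound (x (4 ↑ʳ zero)) (λ i → x (suc (suc (suc (suc (suc i))))))
        = combine a refl bound
        where
        lower : + (n ℕ.* a ℕ.+ c) ≤ Q gram x
        lower = begin
          + (n ℕ.* a) + + c  ≡⟨ cong (_+ + c) (trans (pos-* n a) (cong (_*_ (+ n)) (sym ∑≡a))) ⟩
          + n * _ + + c      ≤⟨ +-monoʳ-≤ (+ n * _) c≤core ⟩
          + n * _ + _        ≡⟨ Q-gram x ⟨
          Q gram x           ∎
          where open ≤-Reasoning
        combine : ∀ a′ → a ≡ a′ → _ → (∀ i → x i ≡ 0ℤ) ⊎ + n ≤ Q gram x
        combine 0 a≡0 (inj₁ (z₀≡0 , z≡0)) = inj₁ λ where
          zero → definite a≡0 zero
          (suc zero) → definite a≡0 (suc zero)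
          (suc (suc zero)) → definite a≡0 (suc (suc zero))
          (suc (suc (suc zero))) → definite a≡0 (suc (suc (suc zero)))
          (suc (suc (suc (suc zero)))) → z₀≡0
          (suc (suc (suc (suc (suc i))))) → z≡0 i
        combine _ _ (inj₂ n≤c) = inj₂ (≤-trans (+≤+ (ℕ.≤-trans n≤c (ℕ.m≤n+m c (n ℕ.* a)))) lower)
        combine (ℕ.suc a′) a≡ (inj₁ _) = inj₂ (≤-trans (+≤+ (ℕ.≤-trans
          (ℕ.≤-trans (ℕ.≤-reflexive (sym (ℕ.*-identityʳ n))) (ℕ.*-monoʳ-≤ n (subst (1 ℕ.≤_) (sym a≡) (s≤s z≤n))))
          (ℕ.m≤m+n (n ℕ.* a) c))) lower)

      isZLattice : IsZLattice gram
      isZLattice = gram-symmetric , λ x x≢0 → [ (λ x≡0 → contradiction x≡0 x≢0) , <-≤-trans (+<+ 0<n) ]′ (minimum x)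

      -- Universality from the norms strictly between `n` and `2 n`.

      module _ (core-represents : ∀ t → 0 ℕ.< t → t ℕ.< n → ∃₂ λ z₀ z → core z₀ z ≡ + (n ℕ.+ t)) where

        private
          instance
            n-nonZero : ℕ.NonZero n
            n-nonZero = ℕ.>-nonZero 0<n

        represents-sum : ∀ e z₀ z → Represents gram (+ n * + e + core z₀ z)
        represents-sum e z₀ z with y₁ , y₂ , y₃ , y₄ , eq ← lagrange e =
          (y₁ ∷ y₂ ∷ y₃ ∷ y₄ ∷ z₀ ∷ z) ,
          trans (Q-gram (y₁ ∷ y₂ ∷ y₃ ∷ y₄ ∷ z₀ ∷ z)) (cong (λ s → + n * s + core z₀ z) (trans (reassociate (y₁ * y₁) (y₂ * y₂) (y₃ * y₃) (y₄ * y₄)) (sym eq)))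
          where
          reassociate : ∀ a b c d → a + (b + (c + (d + 0ℤ))) ≡ a + b + c + d
          reassociate = solve-∀

        core-zero : core 0ℤ (λ _ → 0ℤ) ≡ 0ℤ
        core-zero = trans (cong₂ (λ a b → + g * (0ℤ * 0ℤ) + a + + h * ((0ℤ + 0ℤ - b) * (0ℤ + 0ℤ - b)))
          (weightedSquares-zero (+_ ∘ d)) (∑-zero {k} (λ _ → refl))) (vanish (+ g) (+ h))
          where
          vanish : ∀ g h → g * (0ℤ * 0ℤ) + 0ℤ + h * ((0ℤ + 0ℤ - 0ℤ) * (0ℤ + 0ℤ - 0ℤ)) ≡ 0ℤ
          vanish = solve-∀

        -- Division gives `m - n = t + e n` with `t < n`. For `t > 0` the core contributes `n + t`
        -- and Lagrange's theorem contributes `n e`.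
        represents-≥n : ∀ {m} → n ℕ.≤ m → Represents gram (+ m)
        represents-≥n {m} n≤m with (m ℕ.∸ n) ℕ.% n in r-eq
        -- For `t = 0` the four squares supply all of `m = n (e + 1)` and the core vector is zero;
        -- so nothing is asked of the core when `n = 1`.
        ... | 0 = subst (Represents gram) (begin
            + n * + ℕ.suc e + core 0ℤ (λ _ → 0ℤ)   ≡⟨ cong (_+_ (+ n * + ℕ.suc e)) core-zero ⟩
            + n * + ℕ.suc e + 0ℤ                   ≡⟨ +-identityʳ _ ⟩
            + n * + ℕ.suc e                        ≡⟨ pos-* n (ℕ.suc e) ⟨
            + (n ℕ.* ℕ.suc e)                      ≡⟨ cong +_ m≡ ⟩
            + m                                    ∎)
            (represents-sum (ℕ.suc e) 0ℤ (λ _ → 0ℤ))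
          where
          open ≡-Reasoning
          e = (m ℕ.∸ n) ℕ./ n
          m≡ : n ℕ.* ℕ.suc e ≡ m
          m≡ = trans (trans (ℕ.*-suc n e) (cong (ℕ._+_ n) (trans (ℕ.*-comm n e)
            (sym (trans (m≡m%n+[m/n]*n (m ℕ.∸ n) n) (cong (ℕ._+ e ℕ.* n) r-eq)))))) (ℕ.m+[n∸m]≡n n≤m)
        ... | t@(ℕ.suc _) with z₀ , z , core≡ ← core-represents t (s≤s z≤n) (subst (ℕ._< n) r-eq (m%n<n (m ℕ.∸ n) n)) =
            subst (Represents gram) (begin
            + n * + e + core z₀ z          ≡⟨ cong₂ _+_ (sym (pos-* n e)) core≡ ⟩
            + (n ℕ.* e ℕ.+ (n ℕ.+ t))      ≡⟨ cong +_ m≡ ⟩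
            + m                            ∎)
            (represents-sum e z₀ z)
          where
          open ≡-Reasoning
          e = (m ℕ.∸ n) ℕ./ n
          m≡ : n ℕ.* e ℕ.+ (n ℕ.+ t) ≡ m
          m≡ = trans (trans (regroup n e t) (cong (ℕ._+_ n)
            (sym (trans (m≡m%n+[m/n]*n (m ℕ.∸ n) n) (cong (ℕ._+ e ℕ.* n) r-eq))))) (ℕ.m+[n∸m]≡n n≤m)
            where
            regroup : ∀ n e t → n ℕ.* e ℕ.+ (n ℕ.+ t) ≡ n ℕ.+ (t ℕ.+ e ℕ.* n)
            regroup = ℕSolver.solve-∀

        tightUniversal : TightUniversal n gram
        tightUniversal m = mk⇔
          (λ { (m≢0 , x , refl) → [ (λ x≡0 → contradiction (Q-zero x x≡0) m≢0) , (λ n≤m → n≤m) ]′ (minimum x) })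
          (λ n≤m → (λ { refl → ℕ.<⇒≱ 0<n (drop‿+≤+ n≤m) }) , represented n≤m)
          where
          Q-zero : ∀ x → (∀ i → x i ≡ 0ℤ) → Q gram x ≡ 0ℤ
          Q-zero x x≡0 = ∑-zero λ i → ∑-zero λ j → trans (cong (x i * gram i j *_) (x≡0 j)) (*-zeroʳ (x i * gram i j))
          represented : ∀ {m} → + n ≤ m → Represents gram m
          represented (+≤+ n≤m) = represents-≥n n≤m

  -- The norms of the vectors b_j - a_i and b_j + a_i.

  module _ (n l p : ℕ) where

    private
      q = ℕ.suc l
      h = ℕ.⌊ n /2⌋
      h′ = ℕ.⌈ n /2⌉

    -- The vector b_0 of norm `h` is the head, so the tail holds only b_1, ..., b_l and the index is
    -- shifted by one.
    columnNorm : Fin l → ℕ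
    columnNorm j = ℕ.suc (h ℕ.+ toℕ j)

    rowNorm : Fin p → ℕ
    rowNorm i = h′ ℕ.+ toℕ i ℕ.* q

    -- The choice `g = p q` makes the norms of the sums begin exactly where those of the differences
    -- end.
    open EvenSublattice n h h′ (p ℕ.* q) (columnNorm ++ rowNorm)

    -- The two sides are the rounded-down halves of `n + 1` and `n + 2`.
    h′≤1+h : h′ ℕ.≤ ℕ.suc h
    h′≤1+h = ℕ.⌊n/2⌋-mono {ℕ.suc n} {ℕ.suc (ℕ.suc n)} (ℕ.n≤1+n _)

    -- The hypotheses `z₀² = z₀` and `c² = 1` let one computation serve both the differences and the
    -- sums.
    core-++-single : ∀ z₀ c (y : Fin l → ℤ) (i : Fin p) → z₀ * z₀ ≡ z₀ → c * c ≡ 1ℤ →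
      let w = z₀ + z₀ - (∑ y + c) in
      core z₀ (y ++ single i c)
      ≡ + (p ℕ.* q) * z₀ + (weightedSquares (+_ ∘ columnNorm) y + + rowNorm i) + + h * (w * w)
    core-++-single z₀ c y i z₀²≡z₀ c²≡1 = cong₂ _+_
      (cong₂ (λ a b → + (p ℕ.* q) * a + b) z₀²≡z₀ (trans (weightedSquares-++ columnNorm rowNorm y (single i c))
        (cong (_+_ (weightedSquares (+_ ∘ columnNorm) y)) (trans (weightedSquares-single (+_ ∘ rowNorm) i c)
          (trans (cong (_*_ (+ rowNorm i)) c²≡1) (*-identityʳ _))))))
      (cong (λ s → + h * ((z₀ + z₀ - s) * (z₀ + z₀ - s)))
        (trans (∑-++ y (single i c)) (cong (_+_ (∑ y)) (∑-single i c))))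

    -- (z₀ , c) is (0 , -1) or (1 , 1): the row vector is subtracted from or added to the column vector.
    core-column-row : ∀ z₀ c (j : Fin q) (i : Fin p) → z₀ * z₀ ≡ z₀ → c * c ≡ 1ℤ → z₀ + z₀ - c ≡ 1ℤ →
      ∃ λ z → core z₀ z ≡ + (p ℕ.* q) * z₀ + + (n ℕ.+ (toℕ j ℕ.+ toℕ i ℕ.* q))
    -- Column 0 is the head: the tail has only the row entry, and the head coordinate is
    -- `2 z₀ - c = 1`.
    core-column-row z₀ c zero i z₀²≡z₀ c²≡1 2z₀-c≡1 = ((λ _ → 0ℤ) ++ single i c) , (begin
      core z₀ ((λ _ → 0ℤ) ++ single i c)
        ≡⟨ core-++-single z₀ c (λ _ → 0ℤ) i z₀²≡z₀ c²≡1 ⟩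
      + g * z₀ + (weightedSquares (+_ ∘ columnNorm) (λ _ → 0ℤ) + + rowNorm i) + + h * _
        ≡⟨ cong₂ (λ a b → + g * z₀ + (a + + rowNorm i) + + h * (b * b))
             (weightedSquares-zero (+_ ∘ columnNorm))
             (trans (cong (λ s → z₀ + z₀ - (s + c)) (∑-zero {l} (λ _ → refl))) (trans (drop z₀ c) 2z₀-c≡1)) ⟩
      + g * z₀ + (0ℤ + + rowNorm i) + + h * 1ℤ
        ≡⟨ regroup (+ g * z₀) (+ rowNorm i) (+ h) ⟩
      + g * z₀ + + (h ℕ.+ rowNorm i)
        ≡⟨ cong (λ t → + g * z₀ + + t) (trans (sym (ℕ.+-assoc h h′ _)) (cong (ℕ._+ toℕ i ℕ.* q) (ℕ.⌊n/2⌋+⌈n/2⌉≡n n))) ⟩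
      + g * z₀ + + (n ℕ.+ toℕ i ℕ.* q) ∎)
      where
      open ≡-Reasoning
      g = p ℕ.* q
      drop : ∀ z c → z + z - (0ℤ + c) ≡ z + z - c
      drop = solve-∀
      regroup : ∀ u a h → u + (0ℤ + a) + h * 1ℤ ≡ u + (h + a)
      regroup = solve-∀
    -- Any other column puts a 1 into the tail, and the head coordinate becomes `2 z₀ - 1 - c = 0`.
    core-column-row z₀ c (suc j) i z₀²≡z₀ c²≡1 2z₀-c≡1 = (single j 1ℤ ++ single i c) , (begin
      core z₀ (single j 1ℤ ++ single i c)
        ≡⟨ core-++-single z₀ c (single j 1ℤ) i z₀²≡z₀ c²≡1 ⟩
      + g * z₀ + (weightedSquares (+_ ∘ columnNorm) (single j 1ℤ) + + rowNorm i) + + h * _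
        ≡⟨ cong₂ (λ a b → + g * z₀ + (a + + rowNorm i) + + h * (b * b))
             (trans (weightedSquares-single (+_ ∘ columnNorm) j 1ℤ) (*-identityʳ (+ columnNorm j)))
             (trans (cong (λ s → z₀ + z₀ - (s + c)) (∑-single j 1ℤ)) (trans (shift z₀ c) (cong (_- 1ℤ) 2z₀-c≡1))) ⟩
      + g * z₀ + (+ columnNorm j + + rowNorm i) + + h * 0ℤ
        ≡⟨ trans (cong (_+_ (+ g * z₀ + + (columnNorm j ℕ.+ rowNorm i))) (*-zeroʳ (+ h)))
             (+-identityʳ (+ g * z₀ + + (columnNorm j ℕ.+ rowNorm i))) ⟩
      + g * z₀ + + (columnNorm j ℕ.+ rowNorm i)
        ≡⟨ cong (λ t → + g * z₀ + + t) (trans (regroup h h′ (toℕ j) (toℕ i ℕ.* q))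
             (cong (ℕ._+ (ℕ.suc (toℕ j) ℕ.+ toℕ i ℕ.* q)) (ℕ.⌊n/2⌋+⌈n/2⌉≡n n))) ⟩
      + g * z₀ + + (n ℕ.+ (ℕ.suc (toℕ j) ℕ.+ toℕ i ℕ.* q)) ∎)
      where
      open ≡-Reasoning
      g = p ℕ.* q
      shift : ∀ z c → z + z - (1ℤ + c) ≡ z + z - c - 1ℤ
      shift = solve-∀
      regroup : ∀ h h′ j t → ℕ.suc (h ℕ.+ j) ℕ.+ (h′ ℕ.+ t) ≡ h ℕ.+ h′ ℕ.+ (ℕ.suc j ℕ.+ t)
      regroup = ℕSolver.solve-∀

    -- Division by `q` gives the column `t mod q` and the row `t / q`, which is less than `p`.
    core-block : ∀ {t} z₀ c → t ℕ.< p ℕ.* q → z₀ * z₀ ≡ z₀ → c * c ≡ 1ℤ → z₀ + z₀ - c ≡ 1ℤ →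
      ∃ λ z → core z₀ z ≡ + (p ℕ.* q) * z₀ + + (n ℕ.+ t)
    core-block {t} z₀ c t<pq z₀²≡z₀ c²≡1 2z₀-c≡1
      with z , eq ← core-column-row z₀ c (fromℕ< (m%n<n t q)) (fromℕ< (m<n*o⇒m/o<n t<pq)) z₀²≡z₀ c²≡1 2z₀-c≡1
      = z , trans eq (cong (λ s → + (p ℕ.* q) * z₀ + + (n ℕ.+ s)) (trans
          (cong₂ (λ a b → a ℕ.+ b ℕ.* q) (toℕ-fromℕ< (m%n<n t q)) (toℕ-fromℕ< (m<n*o⇒m/o<n t<pq))) (sym (m≡m%n+[m/n]*n t q))))

    core-represents : ∀ {t} → t ℕ.< p ℕ.* q ℕ.+ p ℕ.* q → ∃₂ λ z₀ z → core z₀ z ≡ + (n ℕ.+ t)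
    core-represents {t} t<2pq with t ℕ.<? p ℕ.* q
    -- The differences b_j - a_i cover the first block of `p q` norms.
    ... | yes t<pq with z , eq ← core-block 0ℤ -1ℤ t<pq refl refl refl =
      0ℤ , z , trans eq (trans (cong (_+ + (n ℕ.+ t)) (*-zeroʳ (+ (p ℕ.* q)))) (+-identityˡ _))
    -- The sums b_j + a_i have `z₀ = 1`, so the extra `g` moves them to the second block.
    ... | no t≮pq
      with u , refl ← ℕ.m≤n⇒∃[o]m+o≡n (ℕ.≮⇒≥ t≮pq)
      with z , eq ← core-block 1ℤ 1ℤ (ℕ.+-cancelˡ-< (p ℕ.* q) u (p ℕ.* q) t<2pq) refl refl refl =
      1ℤ , z , trans eq (trans (cong (_+ + (n ℕ.+ u)) (*-identityʳ (+ (p ℕ.* q))))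
        (cong +_ (regroup (p ℕ.* q) n u)))
      where
      regroup : ∀ g n u → g ℕ.+ (n ℕ.+ u) ≡ n ℕ.+ (g ℕ.+ u)
      regroup = ℕSolver.solve-∀

    tightLattice : 2 ℕ.≤ n → n ℕ.≤ p ℕ.* q ℕ.+ p ℕ.* q → IsZLattice gram × TightUniversal n gram
    tightLattice 2≤n n≤2pq =
      isZLattice 0<n n≤h+h′ n≤2h′ n≤4h h′≤norms ,
      tightUniversal 0<n n≤h+h′ n≤2h′ n≤4h h′≤norms (λ _ _ t<n → core-represents (ℕ.<-≤-trans t<n n≤2pq))
      where
      0<n : 0 ℕ.< n
      0<n = ℕ.≤-trans (s≤s z≤n) 2≤n
      n≤h+h′ : n ℕ.≤ h ℕ.+ h′
      n≤h+h′ = ℕ.≤-reflexive (sym (ℕ.⌊n/2⌋+⌈n/2⌉≡n n))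
      n≤2h′ : n ℕ.≤ h′ ℕ.+ h′
      n≤2h′ = ℕ.≤-trans n≤h+h′ (ℕ.+-monoˡ-≤ h′ (ℕ.⌊n/2⌋≤⌈n/2⌉ n))
      -- This is where `2 ≤ n` enters: for `n = 1` one has `h = 0`, and `n ≤ 4 h` fails.
      1≤h : 1 ℕ.≤ h
      1≤h = ℕ.⌊n/2⌋-mono 2≤n
      n≤4h : n ℕ.≤ h ℕ.* 4
      n≤4h = begin
        n                        ≤⟨ n≤h+h′ ⟩
        h ℕ.+ h′                 ≤⟨ ℕ.+-monoʳ-≤ h (ℕ.≤-trans h′≤1+h (ℕ.+-monoˡ-≤ h 1≤h)) ⟩
        h ℕ.+ (h ℕ.+ h)          ≤⟨ ℕ.+-monoʳ-≤ h (ℕ.+-monoʳ-≤ h (ℕ.m≤m+n h h)) ⟩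
        h ℕ.+ (h ℕ.+ (h ℕ.+ h))  ≡⟨ quadruple h ⟩
        h ℕ.* 4                  ∎
        where
        open ℕ.≤-Reasoning
        quadruple : ∀ h → h ℕ.+ (h ℕ.+ (h ℕ.+ h)) ≡ h ℕ.* 4
        quadruple = ℕSolver.solve-∀
      h′≤norms : ∀ i → h′ ℕ.≤ (columnNorm ++ rowNorm) i
      h′≤norms i with splitAt l i
      ... | inj₁ j = ℕ.≤-trans h′≤1+h (s≤s (ℕ.m≤m+n h (toℕ j)))
      ... | inj₂ j = ℕ.m≤m+n h′ (toℕ j ℕ.* q)

  -- With an empty tail and `g = 0` the form is x₁² + x₂² + x₃² + x₄² + 4 z₀², and Lagrange's
  -- theorem alone suffices: the condition on norms strictly between 1 and 2 is vacuous.
  tightLattice₁ : let open EvenSublattice 1 1 1 0 [] in IsZLattice gram × TightUniversal 1 gram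
  tightLattice₁ =
    isZLattice (s≤s z≤n) (s≤s z≤n) (s≤s z≤n) (s≤s z≤n) (λ ()) ,
    tightUniversal (s≤s z≤n) (s≤s z≤n) (s≤s z≤n) (s≤s z≤n) (λ ())
      (λ _ 0<t t<1 → contradiction 0<t (ℕ.<⇒≱ t<1))
    where open EvenSublattice 1 1 1 0 []

-- The choice of `p` and `q`, and the rank.

open Lattices using (tightLattice; tightLattice₁)
open import Data.Nat using (ℕ; suc; _+_; _*_; _∸_; _/_; _≤_; _<_; z≤n; s≤s)
open import Data.Nat.DivMod using (m≡m%n+[m/n]*n; m%n<n)

s≤2⌈s/2⌉ : ∀ s → s ≤ suc ((s ∸ 1) / 2) + suc ((s ∸ 1) / 2)
s≤2⌈s/2⌉ s = begin
  s                                          ≤⟨ ℕ.m≤n+m∸n s 1 ⟩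
  suc (s ∸ 1)                                ≡⟨ cong suc (m≡m%n+[m/n]*n (s ∸ 1) 2) ⟩
  suc ((s ∸ 1) ℕ.% 2 + (s ∸ 1) / 2 * 2)      ≤⟨ ℕ.+-monoˡ-≤ ((s ∸ 1) / 2 * 2) (m%n<n (s ∸ 1) 2) ⟩
  2 + (s ∸ 1) / 2 * 2                        ≡⟨ double ((s ∸ 1) / 2) ⟩
  suc ((s ∸ 1) / 2) + suc ((s ∸ 1) / 2)      ∎
  where
  open ℕ.≤-Reasoning
  double : ∀ e → 2 + e * 2 ≡ suc e + suc e
  double = ℕSolver.solve-∀

-- Since `(s + 1)² - 1 = s (s + 2)`, the choice `q = s + 2` gives `n ≤ s q`, and `s ≤ 2 p`.
n≤2pq : ∀ {n} s → n < suc s * suc s →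
  let p = suc ((s ∸ 1) / 2); q = suc (suc s) in n ≤ p * q + p * q
n≤2pq {n} s n<[1+s]² = begin
  n              ≤⟨ ℕ.≤-pred (ℕ.<-≤-trans n<[1+s]² (ℕ.≤-reflexive (square s))) ⟩
  s * q          ≤⟨ ℕ.*-monoˡ-≤ q (s≤2⌈s/2⌉ s) ⟩
  (p + p) * q    ≡⟨ ℕ.*-distribʳ-+ q p p ⟩
  p * q + p * q  ∎
  where
  open ℕ.≤-Reasoning
  p = suc ((s ∸ 1) / 2)
  q = suc (suc s)
  square : ∀ s → suc s * suc s ≡ suc (s * suc (suc s))
  square = ℕSolver.solve-∀

-- The inequalities on `s` characterise `s` as the integer part of the square root of `n`; the bound
-- on the least rank is expressed by exhibiting a lattice whose rank satisfies it.
theorem4p3 : (n : ℕ) → 1 ≤ n → (s : ℕ) → s * s ≤ n → n < suc s * suc s →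
    Σ ℕ (λ r → r ≤ (s ∸ 1) / 2 + s + 7 ×
    Σ (Gram r) (λ G → IsZLattice G × TightUniversal n G))
theorem4p3 1 _ s _ _ = 5 ,
  ℕ.≤-trans (ℕ.m≤m+n 5 2) (ℕ.m≤n+m 7 ((s ∸ 1) / 2 + s)) , _ , tightLattice₁
-- Here `l = q - 1 = s + 1`, because b_0 is not a tail coordinate; the rank `5 + l + p` is thus
-- `4 + p + q`.
theorem4p3 n@(suc (suc _)) _ s _ n<[1+s]² = 5 + (suc s + suc ((s ∸ 1) / 2)) ,
  ℕ.≤-reflexive (rank s ((s ∸ 1) / 2)) , _ ,
  tightLattice n (suc s) (suc ((s ∸ 1) / 2)) (s≤s (s≤s z≤n)) (n≤2pq s n<[1+s]²)
  where
  rank : ∀ s e → 5 + (suc s + suc e) ≡ e + s + 7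
  rank = ℕSolver.solve-∀
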